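{- For every integer $n$ and every $d=d(n)$ with $16\le d\le 2^{n/4}$, $\mathsf{OBDD^{\lfloor d/8\rfloor-1}}\subsetneq\mathsf{OBDD^{d}}$ and $\mathsf{NOBDD^{\lfloor d/8\rfloor-1}}\subsetneq\mathsf{NOBDD^{d}}$.
   Context: $\mathsf{OBDD^d}$ (resp. $\mathsf{NOBDD^d}$) denotes the set of Boolean functions $f:\{0,1\}^n\to\{0,1\}$ computable by a deterministic (resp. nondeterministic) OBDD of width $d$ (at most $d$ nodes per level), $n$ being the number of variables. A deterministic OBDD on $x_1,\dots,x_n$ with order $\pi$ (a permutation of $\{1,\dots,n\}$) is a leveled directed acyclic graph with levels $0,\dots,n$, a single source at level $0$, every node at level $j-1$ having exactly one outgoing edge labelled $0$ and one labelled $1$ to nodes at level $j$, and nodes at level $n$ marked accepting or rejecting; on input $\nu$ one follows from the source at step $j$ the edge labelled $\nu_{\pi(j)}$ and outputs $1$ iff an accepting node is reached. A nondeterministic OBDD allows any number of outgoing edges with each label and outputs $1$ iff some consistent path reaches an accepting node. Width is the maximum number of nodes in a level. -}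

module Defs where

open import Data.Nat using (ℕ; zero; suc; _≤_; _<_)
open import Data.Nat.Properties using (<⇒≤)
open import Data.Fin using (Fin; fromℕ<)
open import Data.Fin.Permutation using (Permutation′; _⟨$⟩ʳ_)
open import Data.Bool using (Bool; true)
open import Data.Product using (Σ; _×_)
open import Relation.Binary.PropositionalEquality using (_≡_; subst; sym)
open import Relation.Nullary using (¬_)
open import Function.Bundles using (_⇔_)

BoolFun : ℕ → Set
BoolFun n = (Fin n → Bool) → Bool

-- Deterministic OBDD on n variables of width (at most) d.
-- Levels 0..n; level k has (w k) nodes, numbered Fin (w k).
-- Level 0 consists of the single source. The edge from level k to
-- level k+1 (step k+1 in 1-based numbering) reads variable π(k).
record OBDD (n d : ℕ) : Set where
  field
    π      : Permutation′ n
    w      : ℕ → ℕ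
    w-src  : w 0 ≡ 1
    w-≤    : ∀ k → k ≤ n → w k ≤ d
    δ      : (k : ℕ) → k < n → Fin (w k) → Bool → Fin (w (suc k))
    accept : Fin (w n) → Bool

  source : Fin (w 0)
  source = subst Fin (sym w-src) Fin.zero

  reach : (Fin n → Bool) → (k : ℕ) → k ≤ n → Fin (w k)
  reach ν zero    _ = source
  reach ν (suc k) p = δ k p (reach ν k (<⇒≤ p)) (ν (π ⟨$⟩ʳ fromℕ< p))

  eval : (Fin n → Bool) → Bool
  eval ν = accept (reach ν n Data.Nat.Properties.≤-refl)

-- Nondeterministic OBDD on n variables of width (at most) d.
-- E k p u b v = true iff there is an edge labelled b from node u at
-- level k to node v at level k+1.
record NOBDD (n d : ℕ) : Set where
  field
    π      : Permutation′ n
    w      : ℕ → ℕ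
    w-src  : w 0 ≡ 1
    w-≤    : ∀ k → k ≤ n → w k ≤ d
    E      : (k : ℕ) → k < n → Fin (w k) → Bool → Fin (w (suc k)) → Bool
    accept : Fin (w n) → Bool

  source : Fin (w 0)
  source = subst Fin (sym w-src) Fin.zero

  record AcceptingPath (ν : Fin n → Bool) : Set where
    field
      node    : (k : ℕ) → k ≤ n → Fin (w k)
      start   : node 0 Data.Nat.z≤n ≡ source
      step    : (k : ℕ) (p : k < n) →
                E k p (node k (<⇒≤ p)) (ν (π ⟨$⟩ʳ fromℕ< p)) (node (suc k) p) ≡ true
      finish  : accept (node n Data.Nat.Properties.≤-refl) ≡ true

  Accepts : (Fin n → Bool) → Set
  Accepts ν = AcceptingPath ν

InOBDD : (n d : ℕ) → BoolFun n → Set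
InOBDD n d f = Σ (OBDD n d) λ B → ∀ ν → OBDD.eval B ν ≡ f ν

InNOBDD : (n d : ℕ) → BoolFun n → Set
InNOBDD n d f = Σ (NOBDD n d) λ B → ∀ ν → (f ν ≡ true) ⇔ NOBDD.Accepts B ν

_⊊_ : {n : ℕ} → (BoolFun n → Set) → (BoolFun n → Set) → Set
_⊊_ {n} C D = (∀ f → C f → D f) × Σ (BoolFun n) λ f → D f × ¬ C f

{-# OPTIONS --safe #-}
module Submission where

-- The separating function runs a stack machine on 2t pairs (type bit, value bit): type true pushes
-- the value, type false pops the stack and compares the popped bit with the value; the input is
-- accepted when all comparisons succeed and the stack ends empty.  Here 2^(t+2) ≤ d < 2^(t+3).
-- A machine with stack height at most t, which holds the type bit on top of the stack until the
-- value arrives, has 2^(t+2) states, so the function has width at most d.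
--
-- For the lower bound fix any order and cut it where exactly t of the 2t value variables have been
-- read.  Choose the types greedily: push while the value variable is on the same side of the cut as
-- the values on the stack, pop otherwise.  Then every pop compares two values from opposite sides of
-- the cut, so each side of an accepted input determines the other, while the t pushed values are
-- free.  These 2^t accepted inputs form a fooling set, which forces 2^t > ⌊d/8⌋ nodes at the cut.

open import Defs
open import Data.Nat using (ℕ; _≤_; _^_; _/_; _∸_)
open import Data.Product using (_×_)
open import Data.Nat using (zero; suc; _+_; _*_; _<_; z≤n; s≤s; z<s; s≤s⁻¹; s<s⁻¹; _<ᵇ_; _≤?_; _<?_)
open import Data.Nat.Properties
open import Data.Nat.DivMod using (m<n*o⇒m/o<n; m/n≤m)
open import Data.Bool using (Bool; true; false; not; if_then_else_)
open import Data.Bool.Properties using (¬-not; not-involutive) renaming (_≟_ to _≟ᵇ_)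
open import Data.Fin using (Fin; zero; suc; toℕ; fromℕ<; combine; remQuot)
open import Data.Fin.Properties using (toℕ-fromℕ<; toℕ<n; toℕ-injective; fromℕ<-injective; pigeonhole; 2↔Bool; combine-remQuot) renaming (suc-injective to suc-injectiveᶠ; _≟_ to _≟ᶠ_; <⇒≢ to <⇒≢ᶠ)
open import Data.Fin.Permutation using (_⟨$⟩ʳ_; _⟨$⟩ˡ_; inverseˡ; inverseʳ) renaming (id to idₚ)
open import Data.List using (List; []; _∷_; length; _++_; map) renaming (lookup to lookupᴸ)
open import Data.List.Properties using (length-map; length-++; ∷-injectiveˡ; ∷-injectiveʳ)
open import Data.List.Membership.Propositional using (_∈_)
open import Data.List.Membership.Propositional.Properties using (∈-map⁺; ∈-++⁺ˡ; ∈-++⁺ʳ)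
open import Data.List.Relation.Unary.Any using (here; there; index)
open import Data.List.Relation.Unary.Any.Properties using (lookup-index)
open import Data.Maybe using (Maybe; just; nothing; _>>=_) renaming (map to mapᴹ)
open import Data.Product using (∃; _,_; proj₁; proj₂)
open import Data.Empty using (⊥)
open import Data.Vec using (Vec; []; _∷_; lookup; tabulate; count)
open import Data.Vec.Properties using (tabulate-cong; tabulate∘lookup; lookup∘tabulate) renaming (∷-injectiveˡ to ∷ᵛ-injectiveˡ; ∷-injectiveʳ to ∷ᵛ-injectiveʳ)
open import Function using (_∘_)
open import Function.Bundles using (_⇔_; mk⇔; Equivalence; Inverse; Injection)
open import Function.Properties.Inverse using (↔⇒↣)
open import Relation.Nullary using (¬_; Dec; yes; no; does; contradiction)
open import Relation.Nullary.Decidable using (dec-true; dec-false)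
open import Relation.Binary.PropositionalEquality

-- Monotonicity in the width, and determinism as a case of nondeterminism.

OBDD-mono : ∀ {n m d} → m ≤ d → ∀ f → InOBDD n m f → InOBDD n d f
OBDD-mono {n} {m} {d} m≤d f (B , B-computes) =
  B′ , λ ν → trans (cong accept (reach≡ ν n ≤-refl)) (B-computes ν)
  where
  open OBDD B
  B′ : OBDD n d
  B′ = record { π = π ; w = w ; w-src = w-src ; w-≤ = λ k p → ≤-trans (w-≤ k p) m≤d ; δ = δ ; accept = accept }
  reach≡ : ∀ ν k p → OBDD.reach B′ ν k p ≡ reach ν k p
  reach≡ ν zero    p = refl
  reach≡ ν (suc k) p = cong (λ u → δ k p u _) (reach≡ ν k (<⇒≤ p))

NOBDD-mono : ∀ {n m d} → m ≤ d → ∀ f → InNOBDD n m f → InNOBDD n d f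
NOBDD-mono {n} {m} {d} m≤d f (B , B-computes) =
  B′ , λ ν → mk⇔ (lift ∘ Equivalence.to (B-computes ν)) (Equivalence.from (B-computes ν) ∘ lower)
  where
  open NOBDD B
  B′ : NOBDD n d
  B′ = record { π = π ; w = w ; w-src = w-src ; w-≤ = λ k p → ≤-trans (w-≤ k p) m≤d ; E = E ; accept = accept }
  lift : ∀ {ν} → Accepts ν → NOBDD.Accepts B′ ν
  lift a = record { node = node ; start = start ; step = step ; finish = finish }
    where open AcceptingPath a
  lower : ∀ {ν} → NOBDD.Accepts B′ ν → Accepts ν
  lower a = record { node = node ; start = start ; step = step ; finish = finish }
    where open NOBDD.AcceptingPath a

dec-does : ∀ {p} {P : Set p} (P? : Dec P) → does P? ≡ true → P
dec-does (yes p) _ = p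

-- With the graph of `δ` as edge relation, the only path consistent with an input is the one that
-- `reach` follows.
OBDD⇒NOBDD : ∀ {n d} f → InOBDD n d f → InNOBDD n d f
OBDD⇒NOBDD {n} {d} f (B , B-computes) = N , λ ν → mk⇔
  (λ fν → record
    { node   = reach ν
    ; start  = refl
    ; step   = λ k p → dec-true (reach ν (suc k) p ≟ᶠ reach ν (suc k) p) refl
    ; finish = trans (B-computes ν) fν
    })
  (λ a → let open NOBDD.AcceptingPath a in
    trans (sym (B-computes ν)) (trans (cong accept (sym (node≡reach a n ≤-refl))) finish))
  where
  open OBDD B
  N : NOBDD n d
  N = record { π = π ; w = w ; w-src = w-src ; w-≤ = w-≤ ; E = λ k p u b v → does (δ k p u b ≟ᶠ v) ; accept = accept }
  node≡reach : ∀ {ν} (a : NOBDD.Accepts N ν) k p → NOBDD.AcceptingPath.node a k p ≡ reach ν k p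
  node≡reach a zero z≤n = NOBDD.AcceptingPath.start a
  node≡reach {ν} a (suc k) p = trans
    (sym (dec-does (_ ≟ᶠ _) (NOBDD.AcceptingPath.step a k p)))
    (cong (λ u → δ k p u _) (node≡reach a k (<⇒≤ p)))

-- Splicing accepting paths at a cut; fooling sets.

module _ {n m : ℕ} (B : NOBDD n m) where
  open NOBDD B
  open AcceptingPath

  splice : ∀ {x y z k} (k≤n : k ≤ n) (p : Accepts x) (q : Accepts y) →
           node p k k≤n ≡ node q k k≤n →
           (∀ i → toℕ i < k → z (π ⟨$⟩ʳ i) ≡ x (π ⟨$⟩ʳ i)) →
           (∀ i → k ≤ toℕ i → z (π ⟨$⟩ʳ i) ≡ y (π ⟨$⟩ʳ i)) →
           Accepts z
  splice {x} {y} {z} {k} k≤n p q meet agreeˣ agreeʸ = record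
    { node   = path
    ; start  = trans (path-≤ z≤n z≤n) (start p)
    ; step   = path-step
    ; finish = trans (cong accept (path-≥ k≤n ≤-refl)) (finish q)
    }
    where
    path : (j : ℕ) → j ≤ n → Fin (w j)
    path j j≤n with j ≤? k
    ... | yes _ = node p j j≤n
    ... | no  _ = node q j j≤n

    path-≤ : ∀ {j} → j ≤ k → (j≤n : j ≤ n) → path j j≤n ≡ node p j j≤n
    path-≤ {j} j≤k j≤n with j ≤? k
    ... | yes _   = refl
    ... | no  j≰k = contradiction j≤k j≰k

    path-≥ : ∀ {j} → k ≤ j → (j≤n : j ≤ n) → path j j≤n ≡ node q j j≤n
    path-≥ {j} k≤j j≤n with j ≤? k
    ... | no  _   = refl
    ... | yes j≤k with ≤-antisym j≤k k≤j
    -- At level `k` itself `path` still takes the node of `p`, which `meet` identifies with that of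
    -- `q`.
    ...   | refl rewrite ≤-irrelevant j≤n k≤n = meet

    path-step : ∀ j (j<n : j < n) →
                E j j<n (path j (<⇒≤ j<n)) (z (π ⟨$⟩ʳ fromℕ< j<n)) (path (suc j) j<n) ≡ true
    path-step j j<n with j <? k
    ... | yes j<k
      rewrite path-≤ (<⇒≤ j<k) (<⇒≤ j<n)
            | agreeˣ (fromℕ< j<n) (subst (_< k) (sym (toℕ-fromℕ< j<n)) j<k) = step p j j<n
    ... | no  j≮k
      rewrite path-≥ (≮⇒≥ j≮k) (<⇒≤ j<n)
            | agreeʸ (fromℕ< j<n) (subst (k ≤_) (sym (toℕ-fromℕ< j<n)) (≮⇒≥ j≮k)) = step q j j<n

  cut-mix : ℕ → (x y : Fin n → Bool) → Fin n → Bool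
  cut-mix k x y v = if toℕ (π ⟨$⟩ˡ v) <ᵇ k then x v else y v

  -- Level `k` has fewer nodes than there are inputs, so two accepting paths meet there and can be
  -- spliced.
  fooling : ∀ {N k} → m < N → k ≤ n → (x : Fin N → Fin n → Bool) → (∀ i → Accepts (x i)) →
            ∃ λ i → ∃ λ j → i ≢ j × Accepts (cut-mix k (x i) (x j))
  fooling {k = k} m<N k≤n x acc
    with pigeonhole (≤-<-trans (w-≤ k k≤n) m<N) (λ i → node (acc i) k k≤n)
  ... | i , j , i<j , meet = i , j , <⇒≢ᶠ i<j , splice k≤n (acc i) (acc j) meet before after
    where
    before : ∀ l → toℕ l < k → cut-mix k (x i) (x j) (π ⟨$⟩ʳ l) ≡ x i (π ⟨$⟩ʳ l)
    before l l<k rewrite inverseˡ π {l} | dec-true (toℕ l <? k) l<k = refl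
    after : ∀ l → k ≤ toℕ l → cut-mix k (x i) (x j) (π ⟨$⟩ʳ l) ≡ x j (π ⟨$⟩ʳ l)
    after l k≤l rewrite inverseˡ π {l} | dec-false (toℕ l <? k) (≤⇒≯ k≤l) = refl

-- OBDDs from finite-state machines.

ext : ∀ {n} → (Fin n → Bool) → ℕ → Bool
ext {n} ν q with q <? n
... | yes q<n = ν (fromℕ< q<n)
... | no  _   = false

ext-< : ∀ {n} (ν : Fin n → Bool) {q} (q<n : q < n) → ext ν q ≡ ν (fromℕ< q<n)
ext-< {n} ν {q} q<n with q <? n
... | yes _   = refl
... | no  q≮n = contradiction q<n q≮n

-- `S` may be infinite: storing a state in one of `N` nodes replaces it by its `cap`, so the OBDD
-- follows the run that applies `cap` after every step.
module Machine {S : Set} {N : ℕ} (enc : S → Fin N) (dec : Fin N → S)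
               (cap : S → S) (dec∘enc : ∀ s → dec (enc s) ≡ cap s)
               (step : ℕ → S → Bool → S) (s₀ : S) where

  iter : (ℕ → Bool) → ℕ → S
  iter x zero    = s₀
  iter x (suc k) = cap (step k (iter x k) (x k))

  module _ {n d : ℕ} (1≤d : 1 ≤ d) (N≤d : N ≤ d) (acc : S → Bool) where
    width : ℕ → ℕ
    width zero    = 1
    width (suc _) = N

    state : ∀ k → Fin (width k) → S
    state zero    _ = s₀
    state (suc k) u = dec u

    obdd : OBDD n d
    obdd = record
      { π      = idₚ
      ; w      = width
      ; w-src  = refl
      ; w-≤    = λ { zero _ → 1≤d ; (suc _) _ → N≤d }
      ; δ      = λ k _ u b → enc (step k (state k u) b)
      ; accept = acc ∘ state n
      }

    state-reach : ∀ ν k p → state k (OBDD.reach obdd ν k p) ≡ iter (ext ν) k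
    state-reach ν zero    p = refl
    state-reach ν (suc k) p = trans (dec∘enc _) (cong cap
      (cong₂ (step k) (state-reach ν k (<⇒≤ p)) (sym (ext-< ν p))))

    eval≡iter : ∀ ν → OBDD.eval obdd ν ≡ acc (iter (ext ν) n)
    eval≡iter ν = cong acc (state-reach ν n ≤-refl)

-- Bounded stacks as machine states.

-- A stack, top first, or nothing once the input is known to be rejected.
State : Set
State = Maybe (List Bool)

strings : ℕ → List (List Bool)
strings zero    = [] ∷ []
strings (suc b) = [] ∷ map (true ∷_) (strings b) ++ map (false ∷_) (strings b)

-- The added one accounts for `nothing`, so that the states number exactly a power of two.
length-strings : ∀ b → suc (length (strings b)) ≡ 2 ^ suc b
length-strings zero    = refl
length-strings (suc b) = begin
  2 + length (map (true ∷_) (strings b) ++ map (false ∷_) (strings b))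
    ≡⟨ cong (2 +_) (length-++ (map (true ∷_) (strings b))) ⟩
  2 + (length (map (true ∷_) (strings b)) + length (map (false ∷_) (strings b)))
    ≡⟨ cong₂ (λ j k → 2 + (j + k)) (length-map (true ∷_) (strings b)) (length-map (false ∷_) (strings b)) ⟩
  2 + (length (strings b) + length (strings b))
    ≡⟨ cong suc (+-suc _ _) ⟨
  suc (length (strings b)) + suc (length (strings b))
    ≡⟨ cong₂ _+_ (length-strings b) (trans (length-strings b) (sym (+-identityʳ _))) ⟩
  2 ^ (2 + b) ∎
  where open ≡-Reasoning

∈-strings : ∀ b s → length s ≤ b → s ∈ strings b
∈-strings zero    []          _ = here refl
∈-strings (suc b) []          _ = here refl
∈-strings (suc b) (true  ∷ s) p = there (∈-++⁺ˡ (∈-map⁺ _ (∈-strings b s (s≤s⁻¹ p))))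
∈-strings (suc b) (false ∷ s) p = there (∈-++⁺ʳ (map (true ∷_) (strings b)) (∈-map⁺ _ (∈-strings b s (s≤s⁻¹ p))))

module Capped (b : ℕ) where
  states : List State
  states = nothing ∷ map just (strings b)

  length-states : length states ≡ 2 ^ suc b
  length-states = trans (cong suc (length-map just (strings b))) (length-strings b)

  enc : State → Fin (length states)
  enc nothing = zero
  enc (just s) with length s ≤? b
  ... | yes p = suc (index (∈-map⁺ just (∈-strings b s p)))
  -- Index zero is `nothing`: an overflowing stack leads to rejection.
  ... | no  _ = zero

  dec : Fin (length states) → State
  dec = lookupᴸ states

  cap : State → State
  cap nothing = nothing
  cap (just s) with length s ≤? b
  ... | yes _ = just s
  ... | no  _ = nothing

  dec∘enc : ∀ m → dec (enc m) ≡ cap m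
  dec∘enc nothing = refl
  dec∘enc (just s) with length s ≤? b
  ... | yes p = sym (lookup-index (∈-map⁺ just (∈-strings b s p)))
  ... | no  _ = refl

  cap-≤ : ∀ {s} → length s ≤ b → cap (just s) ≡ just s
  cap-≤ {s} p with length s ≤? b
  ... | yes _ = refl
  ... | no ¬p = contradiction p ¬p

  cap-≰ : ∀ {s} → ¬ (length s ≤ b) → cap (just s) ≡ nothing
  cap-≰ {s} ¬p with length s ≤? b
  ... | yes p = contradiction p ¬p
  ... | no  _ = refl

  cap-idem : ∀ m → cap (cap m) ≡ cap m
  cap-idem nothing  = refl
  cap-idem (just s) with length s ≤? b
  ... | yes p = cap-≤ p
  ... | no  _ = refl

-- The stack machine and its accepting runs.

exec : Bool → List Bool → State
exec v (true  ∷ s)     = just (v ∷ s)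
exec v (false ∷ x ∷ s) = if does (x ≟ᵇ v) then just s else nothing
exec v (false ∷ [])    = nothing
exec v []              = nothing

-- step P k reads variable k of a machine with P pairs, which ignores the variables from 2P on.
step : ℕ → ℕ → State → Bool → State
step zero    _             m _ = m
step (suc P) zero          m τ = mapᴹ (τ ∷_) m
step (suc P) (suc zero)    m v = m >>= exec v
step (suc P) (suc (suc k)) m b = step P k m b

isEmpty : State → Bool
isEmpty (just [])      = true
isEmpty (just (_ ∷ _)) = false
isEmpty nothing        = false

evens odds : ∀ P → (ℕ → Bool) → Vec Bool P
evens P x = tabulate λ i → x (toℕ i * 2)
odds  P x = tabulate λ i → x (suc (toℕ i * 2))

Run : ∀ (t : ℕ) {P} → Vec Bool P → Vec Bool P → List Bool → Set
Run t []           []       s       = s ≡ []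
Run t (true  ∷ τs) (v ∷ vs) s       = length s ≤ t × Run t τs vs (v ∷ s)
Run t (false ∷ τs) (v ∷ vs) []      = ⊥
Run t (false ∷ τs) (v ∷ vs) (x ∷ s) = length (x ∷ s) ≤ t × x ≡ v × Run t τs vs s

module StackMachine (t : ℕ) where
  -- The extra position is for the type bit on top of up to `t` values; this gives 2^(t+2) states.
  open Capped (suc t) public

  block : State → Bool → Bool → State
  block m τ v = cap (cap (mapᴹ (τ ∷_) m) >>= exec v)

  runBlocks : ∀ {P} → Vec Bool P → Vec Bool P → State → State
  runBlocks []       []       m = m
  runBlocks (τ ∷ τs) (v ∷ vs) m = runBlocks τs vs (block m τ v)

  module _ (P : ℕ) (m : State) where
    open Machine enc dec cap dec∘enc (step P) m public using (iter; obdd; eval≡iter)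

  iter-tail : ∀ P m x k → iter (suc P) m x (2 + k) ≡ iter P (block m (x 0) (x 1)) (x ∘ (2 +_)) k
  iter-tail P m x zero    = refl
  iter-tail P m x (suc k) = cong (λ m′ → cap (step P k m′ (x (2 + k)))) (iter-tail P m x k)

  -- Once the pairs are exhausted each further step only applies `cap`, which is why `m` has to be
  -- fixed by `cap`.
  iter≡runBlocks : ∀ P m x k → cap m ≡ m → P * 2 ≤ k →
                   iter P m x k ≡ runBlocks (evens P x) (odds P x) m
  iter≡runBlocks zero m x zero    _ _ = refl
  iter≡runBlocks zero m x (suc k) e _ = trans (cong cap (iter≡runBlocks zero m x k e z≤n)) e
  iter≡runBlocks (suc P) m x (suc (suc k)) e (s≤s (s≤s p)) = trans (iter-tail P m x k)
    (iter≡runBlocks P _ (x ∘ (2 +_)) k (cap-idem (cap (mapᴹ (x 0 ∷_) m) >>= exec (x 1))) p)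

  runBlocks-nothing : ∀ {P} (τs vs : Vec Bool P) → runBlocks τs vs nothing ≡ nothing
  runBlocks-nothing []       []       = refl
  runBlocks-nothing (τ ∷ τs) (v ∷ vs) = runBlocks-nothing τs vs

  runBlocks-complete : ∀ {P} (τs vs : Vec Bool P) s → Run t τs vs s → runBlocks τs vs (just s) ≡ just []
  runBlocks-complete []           []       s       refl = refl
  runBlocks-complete (true  ∷ τs) (v ∷ vs) s       (p , r)
    rewrite cap-≤ {true ∷ s} (s≤s p) | cap-≤ {v ∷ s} (s≤s p) = runBlocks-complete τs vs (v ∷ s) r
  runBlocks-complete (false ∷ τs) (v ∷ vs) (x ∷ s) (p , refl , r)
    rewrite cap-≤ {false ∷ x ∷ s} (s≤s p) | dec-true (x ≟ᵇ x) refl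
          | cap-≤ {s} (≤-trans (n≤1+n _) (m≤n⇒m≤1+n p)) = runBlocks-complete τs vs s r

  -- A failed comparison, a pop from the empty stack or a height above `t` before a pair all lead to
  -- `nothing`, which is absorbing and not accepted.
  runBlocks-sound : ∀ {P} (τs vs : Vec Bool P) s → isEmpty (runBlocks τs vs (just s)) ≡ true → Run t τs vs s
  runBlocks-sound []       []       []      e = refl
  runBlocks-sound (τ ∷ τs) (v ∷ vs) s       e with length s ≤? t
  runBlocks-sound (τ ∷ τs) (v ∷ vs) s       e | no ¬p
    rewrite cap-≰ {τ ∷ s} (¬p ∘ s≤s⁻¹) | runBlocks-nothing τs vs = contradiction e λ ()
  runBlocks-sound (true ∷ τs) (v ∷ vs) s e | yes p
    rewrite cap-≤ {true ∷ s} (s≤s p) | cap-≤ {v ∷ s} (s≤s p) = p , runBlocks-sound τs vs (v ∷ s) e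
  runBlocks-sound (false ∷ τs) (v ∷ vs) [] e | yes p
    rewrite cap-≤ {false ∷ []} (s≤s p) | runBlocks-nothing τs vs = contradiction e λ ()
  runBlocks-sound (false ∷ τs) (v ∷ vs) (x ∷ s) e | yes p
    rewrite cap-≤ {false ∷ x ∷ s} (s≤s p) with x ≟ᵇ v
  ... | yes x≡v rewrite cap-≤ {s} (≤-trans (n≤1+n _) (m≤n⇒m≤1+n p)) = p , x≡v , runBlocks-sound τs vs s e
  ... | no  _   rewrite runBlocks-nothing τs vs = contradiction e λ ()

-- Greedy types and the values accepted with them.

occ : ∀ {P} → Bool → Vec Bool P → ℕ
occ c = count (_≟ᵇ c)

occ-tail : ∀ {P} c o (os : Vec Bool P) → occ c os ≤ occ c (o ∷ os)
occ-tail c o os with o ≟ᵇ c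
... | yes _ = n≤1+n _
... | no  _ = ≤-refl

occ-total : ∀ {P} (os : Vec Bool P) → occ true os + occ false os ≡ P
occ-total []           = refl
occ-total (true  ∷ os) = cong suc (occ-total os)
occ-total (false ∷ os) = trans (+-suc _ _) (cong suc (occ-total os))

-- os lists the side of the cut of each value variable; c is the side of all values currently on the
-- stack (irrelevant when it is empty), and h is the stack height.
greedy : ∀ {P} → Vec Bool P → Bool → ℕ → Vec Bool P
greedy []       c h    = []
greedy (o ∷ os) c zero = true ∷ greedy os o 1
greedy (o ∷ os) c (suc h) with o ≟ᵇ c
... | yes _ = true  ∷ greedy os c (2 + h)
... | no  _ = false ∷ greedy os c h

-- The accepted values for the greedy types whose pushed bits are taken from the stream α.
fill : ∀ {P} → Vec Bool P → Bool → List Bool → (ℕ → Bool) → Vec Bool P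
fill []       c s  α = []
fill (o ∷ os) c [] α = α 0 ∷ fill os o (α 0 ∷ []) (α ∘ suc)
fill (o ∷ os) c (x ∷ s) α with o ≟ᵇ c
... | yes _ = α 0 ∷ fill os c (α 0 ∷ x ∷ s) (α ∘ suc)
... | no  _ = x ∷ fill os c s α

-- Exactly the condition for the stack to end empty; the number of pushes to come is then occ c os.
Balanced : ∀ {P} → Vec Bool P → Bool → ℕ → Set
Balanced os c h = h + occ c os ≡ occ (not c) os

-- With an empty stack, balance is symmetric in the two sides, so the side can be reset to that of
-- the value about to be pushed.
balanced-start : ∀ {P} o c (os : Vec Bool P) → Balanced (o ∷ os) c 0 → Balanced os o 1
balanced-start true  true  os e = e
balanced-start true  false os e = sym e
balanced-start false true  os e = sym e
balanced-start false false os e = e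

balanced-push : ∀ {P} c h (os : Vec Bool P) → h + suc (occ c os) ≡ occ (not c) (c ∷ os) → Balanced os c (suc h)
balanced-push true  h os e = trans (sym (+-suc h _)) e
balanced-push false h os e = trans (sym (+-suc h _)) e

balanced-pop : ∀ {P} {o c h} (os : Vec Bool P) → o ≢ c → suc h + occ c os ≡ occ (not c) (o ∷ os) → Balanced os c h
balanced-pop {o = true}  {true}  os o≢c e = contradiction refl o≢c
balanced-pop {o = true}  {false} os o≢c e = suc-injective e
balanced-pop {o = false} {true}  os o≢c e = suc-injective e
balanced-pop {o = false} {false} os o≢c e = contradiction refl o≢c

fill-run : ∀ t {P} (os : Vec Bool P) c s α → Balanced os c (length s) → (∀ b → occ b os ≤ t) →
           Run t (greedy os c (length s)) (fill os c s α) s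
fill-run t []       c []      α bal bnd = refl
fill-run t []       c (x ∷ s) α () bnd
fill-run t (o ∷ os) c [] α bal bnd =
  z≤n , fill-run t os o (α 0 ∷ []) _ (balanced-start o c os bal) (λ b → ≤-trans (occ-tail b o os) (bnd b))
fill-run t (o ∷ os) c (x ∷ s) α bal bnd with o ≟ᵇ c
... | yes refl = height≤t , fill-run t os c (α 0 ∷ x ∷ s) _ (balanced-push c _ os bal) bnd′
  where
  -- By balance the height is at most the number of values still to come on the opposite side.
  height≤t = ≤-trans (m≤m+n _ _) (≤-trans (≤-reflexive bal) (bnd (not c)))
  bnd′ = λ b → ≤-trans (occ-tail b o os) (bnd b)
... | no o≢c = height≤t , refl , fill-run t os c s α (balanced-pop os o≢c bal) bnd′
  where
  height≤t = ≤-trans (m≤m+n _ _) (≤-trans (≤-reflexive bal) (bnd (not c)))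
  bnd′ = λ b → ≤-trans (occ-tail b o os) (bnd b)

-- Each push outputs the next bit of the stream, and pops consume none. Equal outputs thus keep the
-- two stacks equal and reveal the bits one by one.
fill-injective : ∀ {P} (os : Vec Bool P) c s {α β} → Balanced os c (length s) →
                 fill os c s α ≡ fill os c s β → ∀ {i} → i < occ c os → α i ≡ β i
fill-injective (o ∷ os) c [] {α} {β} bal eq {zero}  _ = ∷ᵛ-injectiveˡ eq
fill-injective (o ∷ os) c [] {α} {β} bal eq {suc i} i< =
  fill-injective os o (α 0 ∷ []) (balanced-start o c os bal)
    (subst (λ a → _ ≡ fill os o (a ∷ []) (β ∘ suc)) (sym (∷ᵛ-injectiveˡ eq)) (∷ᵛ-injectiveʳ eq))
    (s<s⁻¹ (subst (suc i <_) (occ-start o c bal) i<))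
  where
  -- The side may change from `c` to `o` here, but balance makes both counts equal, and one push is
  -- used up.
  occ-start : ∀ o c → Balanced (o ∷ os) c 0 → occ c (o ∷ os) ≡ suc (occ o os)
  occ-start true  true  e = refl
  occ-start true  false e = e
  occ-start false true  e = e
  occ-start false false e = refl
fill-injective (o ∷ os) c (x ∷ s) {α} {β} bal eq {i} i< with o ≟ᵇ c
... | no o≢c = fill-injective os c s (balanced-pop os o≢c bal) (∷ᵛ-injectiveʳ eq) i<
... | yes refl with i
...   | zero  = ∷ᵛ-injectiveˡ eq
...   | suc j = fill-injective os c (α 0 ∷ x ∷ s) (balanced-push c _ os bal)
    (subst (λ a → _ ≡ fill os c (a ∷ x ∷ s) (β ∘ suc)) (sym (∷ᵛ-injectiveˡ eq)) (∷ᵛ-injectiveʳ eq))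
    (s<s⁻¹ i<)

-- When c is the side A on which the runs agree, their stacks agree from the start; otherwise the
-- stacks agree because their contents will be compared with values on side A.
run-determined : ∀ {t P} A (os : Vec Bool P) c {h vs ws s s′} →
                 (∀ i → lookup os i ≡ A → lookup vs i ≡ lookup ws i) →
                 length s ≡ h → length s′ ≡ h → (c ≡ A → s ≡ s′) →
                 Run t (greedy os c h) vs s → Run t (greedy os c h) ws s′ →
                 vs ≡ ws × s ≡ s′
run-determined A [] c {vs = []} {[]} agr l l′ s≡ refl refl = refl , refl
run-determined A (o ∷ os) c {zero} {v ∷ vs} {w ∷ ws} {[]} {[]} agr l l′ s≡ (_ , r) (_ , r′)
  with run-determined A os o (agr ∘ suc) refl refl (λ o≡A → cong (_∷ []) (agr zero o≡A)) r r′
... | refl , refl = refl , refl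
run-determined A (o ∷ os) c {suc h} {v ∷ vs} {w ∷ ws} {x ∷ s} {y ∷ s′} agr l l′ s≡ r r′ with o ≟ᵇ c
run-determined A (o ∷ os) c {suc h} {v ∷ vs} {w ∷ ws} {x ∷ s} {y ∷ s′} agr l l′ s≡ (_ , r) (_ , r′) | yes refl
  with run-determined A os c (agr ∘ suc) (cong suc l) (cong suc l′) (λ c≡A → cong₂ _∷_ (agr zero c≡A) (s≡ c≡A)) r r′
... | refl , refl = refl , refl
run-determined A (o ∷ os) c {suc h} {v ∷ vs} {w ∷ ws} {x ∷ s} {y ∷ s′} agr l l′ s≡ (_ , refl , r) (_ , refl , r′) | no o≢c
  with run-determined A os c (agr ∘ suc) (suc-injective l) (suc-injective l′) (∷-injectiveʳ ∘ s≡) r r′ | c ≟ᵇ A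
... | refl , refl | yes c≡A = cong (_∷ _) (∷-injectiveˡ (s≡ c≡A)) , s≡ c≡A
-- Here `o` differs from `c` and `c` from `A`, so the value compared with the popped bit lies on
-- side `A`.
... | refl , refl | no c≢A with agr zero (trans (¬-not o≢c) (trans (cong not (¬-not c≢A)) (not-involutive A)))
...   | refl = refl , refl

-- Counting the variables before a cut.

<ᵇ-suc : ∀ m k → m ≢ k → (m <ᵇ suc k) ≡ (m <ᵇ k)
<ᵇ-suc zero    zero    m≢k = contradiction refl m≢k
<ᵇ-suc zero    (suc k) m≢k = refl
<ᵇ-suc (suc m) zero    m≢k = refl
<ᵇ-suc (suc m) (suc k) m≢k = <ᵇ-suc m k (m≢k ∘ cong suc)

below : ∀ {P} → (Fin P → ℕ) → ℕ → Vec Bool P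
below g k = tabulate λ i → g i <ᵇ k

-- Only an index with `g i` equal to `k` is new, and injectivity allows at most one.
occ-below-suc : ∀ {P} (g : Fin P → ℕ) → (∀ {i j} → g i ≡ g j → i ≡ j) → ∀ k →
                occ true (below g (suc k)) ≤ suc (occ true (below g k))
occ-below-suc {zero}  g inj k = z≤n
occ-below-suc {suc P} g inj k with g zero ≟ k
... | yes refl rewrite tabulate-cong {f = λ i → g (suc i) <ᵇ suc k} {λ i → g (suc i) <ᵇ k}
                         (λ i → <ᵇ-suc (g (suc i)) k (λ e → contradiction (inj e) λ ())) =
  ≤-trans (occ-head (g zero <ᵇ suc k) os) (s≤s (occ-tail true (g zero <ᵇ k) os))
  where
  os = below (g ∘ suc) k
  occ-head : ∀ {P} o (os : Vec Bool P) → occ true (o ∷ os) ≤ suc (occ true os)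
  occ-head true  os = ≤-refl
  occ-head false os = n≤1+n _
... | no g₀≢k rewrite <ᵇ-suc (g zero) k g₀≢k with g zero <ᵇ k
...   | true  = s≤s (occ-below-suc (g ∘ suc) (λ e → suc-injectiveᶠ (inj e)) k)
...   | false = occ-below-suc (g ∘ suc) (λ e → suc-injectiveᶠ (inj e)) k

occ-below-zero : ∀ {P} (g : Fin P → ℕ) → occ true (below g 0) ≡ 0
occ-below-zero {zero}  g = refl
occ-below-zero {suc P} g = occ-below-zero (g ∘ suc)

occ-below-all : ∀ {P} (g : Fin P → ℕ) {k} → (∀ i → g i < k) → occ true (below g k) ≡ P
occ-below-all {zero}  g g< = refl
occ-below-all {suc P} g {k} g< rewrite dec-true (g zero <? k) (g< zero) =
  cong suc (occ-below-all (g ∘ suc) (g< ∘ suc))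

intermediate-value : ∀ (f : ℕ → ℕ) {t} → f 0 ≤ t → (∀ k → f (suc k) ≤ suc (f k)) →
                     ∀ n → t ≤ f n → ∃ λ k → k ≤ n × f k ≡ t
intermediate-value f f₀≤t f-suc zero    t≤f = 0 , z≤n , ≤-antisym f₀≤t t≤f
intermediate-value f {t} f₀≤t f-suc (suc n) t≤f with t ≤? f n
... | yes t≤fn = let k , k≤n , e = intermediate-value f f₀≤t f-suc n t≤fn in k , m≤n⇒m≤1+n k≤n , e
... | no  t≰fn = suc n , ≤-refl , ≤-antisym (≤-trans (f-suc n) (≰⇒> t≰fn)) t≤f

-- Free bits and their placement in an input.

-- Binary digits, most significant first, padded with `false` to a stream as `fill` expects.
bits : ∀ t → Fin (2 ^ t) → ℕ → Bool
bits zero    j q       = false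
bits (suc t) j zero    = Inverse.to 2↔Bool (proj₁ (remQuot {2} (2 ^ t) j))
bits (suc t) j (suc q) = bits t (proj₂ (remQuot {2} (2 ^ t) j)) q

bits-injective : ∀ t {i j} → (∀ {q} → q < t → bits t i q ≡ bits t j q) → i ≡ j
bits-injective zero    {zero} {zero} _  = refl
bits-injective (suc t) {i}    {j}    eq = begin
  i                                                          ≡⟨ combine-remQuot {2} (2 ^ t) i ⟨
  combine (proj₁ (remQuot {2} (2 ^ t) i)) (proj₂ (remQuot {2} (2 ^ t) i))
    ≡⟨ cong₂ combine (Injection.injective (↔⇒↣ 2↔Bool) (eq z<s)) (bits-injective t (eq ∘ s≤s)) ⟩
  combine (proj₁ (remQuot {2} (2 ^ t) j)) (proj₂ (remQuot {2} (2 ^ t) j))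
                                                             ≡⟨ combine-remQuot {2} (2 ^ t) j ⟩
  j                                                          ∎
  where open ≡-Reasoning

interleave : ∀ {P} → Vec Bool P → Vec Bool P → ℕ → Bool
interleave []       []       q             = false
interleave (τ ∷ τs) (v ∷ vs) zero          = τ
interleave (τ ∷ τs) (v ∷ vs) (suc zero)    = v
interleave (τ ∷ τs) (v ∷ vs) (suc (suc q)) = interleave τs vs q

interleave-even : ∀ {P} (τs vs : Vec Bool P) i → interleave τs vs (toℕ i * 2) ≡ lookup τs i
interleave-even (τ ∷ τs) (v ∷ vs) zero    = refl
interleave-even (τ ∷ τs) (v ∷ vs) (suc i) = interleave-even τs vs i

interleave-odd : ∀ {P} (τs vs : Vec Bool P) i → interleave τs vs (suc (toℕ i * 2)) ≡ lookup vs i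
interleave-odd (τ ∷ τs) (v ∷ vs) zero    = refl
interleave-odd (τ ∷ τs) (v ∷ vs) (suc i) = interleave-odd τs vs i

-- The lower bound for any order.

module PairedVariables {n : ℕ} (t : ℕ) (vars≤n : (t + t) * 2 ≤ n) where
  valVar<n : ∀ (i : Fin (t + t)) → suc (toℕ i * 2) < n
  valVar<n i = ≤-trans (*-monoˡ-≤ 2 (toℕ<n i)) vars≤n

  typeVar<n : ∀ (i : Fin (t + t)) → toℕ i * 2 < n
  typeVar<n i = <⇒≤ (valVar<n i)

  typeVar valVar : Fin (t + t) → Fin n
  typeVar i = fromℕ< (typeVar<n i)
  valVar  i = fromℕ< (valVar<n i)

  valVar-injective : ∀ {i j} → valVar i ≡ valVar j → i ≡ j
  valVar-injective {i} {j} e = toℕ-injective (*-cancelʳ-≡ (toℕ i) (toℕ j) 2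
    (suc-injective (fromℕ<-injective _ _ (valVar<n i) (valVar<n j) e)))

  StackAccepted : (Fin n → Bool) → Set
  StackAccepted ν = Run t (tabulate (ν ∘ typeVar)) (tabulate (ν ∘ valVar)) []

  StackAccepted-hard : ∀ {f m} → m < 2 ^ t → (∀ ν → f ν ≡ true ⇔ StackAccepted ν) → ¬ InNOBDD n m f
  StackAccepted-hard {f} {m} m<2^t f-correct (B , B-computes) =
    let k , k≤n , occ≡t = halving-cut in no-halving-cut k≤n occ≡t
    where
    open NOBDD B using (π)

    position : Fin (t + t) → ℕ
    position i = toℕ (π ⟨$⟩ˡ valVar i)

    position-injective : ∀ {i j} → position i ≡ position j → i ≡ j
    position-injective e = valVar-injective
      (trans (sym (inverseʳ π)) (trans (cong (π ⟨$⟩ʳ_) (toℕ-injective e)) (inverseʳ π)))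

    -- The count starts at 0, ends at 2t and grows by at most one per level, so it passes through
    -- `t`.
    halving-cut : ∃ λ k → k ≤ n × occ true (below position k) ≡ t
    halving-cut = intermediate-value (occ true ∘ below position)
      (subst (_≤ t) (sym (occ-below-zero position)) z≤n)
      (occ-below-suc position position-injective) n
      (subst (t ≤_) (sym (occ-below-all position (λ i → toℕ<n (π ⟨$⟩ˡ valVar i)))) (m≤m+n t t))

    no-halving-cut : ∀ {k} → k ≤ n → ¬ occ true (below position k) ≡ t
    no-halving-cut {k} k≤n occ-true≡t =
      let i , j , i≢j , accepted = fooling B m<2^t k≤n input input-accepted
      in i≢j (bits-injective t (bits≡ i j accepted))
      where
      os : Vec Bool (t + t)
      os = below position k

      occ≡t : ∀ b → occ b os ≡ t
      occ≡t true  = occ-true≡t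
      occ≡t false = +-cancelˡ-≡ t _ _ (trans (cong (_+ occ false os) (sym occ-true≡t)) (occ-total os))

      balanced : Balanced os true 0
      balanced = trans (occ≡t true) (sym (occ≡t false))

      types : Vec Bool (t + t)
      types = greedy os true 0

      vals : Fin (2 ^ t) → Vec Bool (t + t)
      vals j = fill os true [] (bits t j)

      vals-run : ∀ j → Run t types (vals j) []
      vals-run j = fill-run t os true [] (bits t j) balanced (λ b → ≤-reflexive (occ≡t b))

      input : Fin (2 ^ t) → Fin n → Bool
      input j v = interleave types (vals j) (toℕ v)

      input-type : ∀ j l → input j (typeVar l) ≡ lookup types l
      input-type j l = trans (cong (interleave types (vals j)) (toℕ-fromℕ< (typeVar<n l)))
        (interleave-even types (vals j) l)

      input-val : ∀ j l → input j (valVar l) ≡ lookup (vals j) l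
      input-val j l = trans (cong (interleave types (vals j)) (toℕ-fromℕ< (valVar<n l)))
        (interleave-odd types (vals j) l)

      tabulate-≡ : ∀ {P} {f : Fin P → Bool} {xs} → (∀ i → f i ≡ lookup xs i) → tabulate f ≡ xs
      tabulate-≡ {xs = xs} e = trans (tabulate-cong e) (tabulate∘lookup xs)

      input-accepted : ∀ j → NOBDD.Accepts B (input j)
      input-accepted j = Equivalence.to (B-computes (input j)) (Equivalence.from (f-correct (input j))
        (subst₂ (λ τs vs → Run t τs vs []) (sym (tabulate-≡ (input-type j))) (sym (tabulate-≡ (input-val j)))
          (vals-run j)))

      module _ (i j : Fin (2 ^ t)) (accepted : NOBDD.Accepts B (cut-mix B k (input i) (input j))) where
        mixed : Fin n → Bool
        mixed = cut-mix B k (input i) (input j)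

        -- All the fooling inputs share their type bits, so it does not matter on which side of the
        -- cut a type variable is read.
        mixed-type : ∀ l → mixed (typeVar l) ≡ lookup types l
        mixed-type l with toℕ (π ⟨$⟩ˡ typeVar l) <ᵇ k
        ... | true  = input-type i l
        ... | false = input-type j l

        mixed-run : Run t types (tabulate (mixed ∘ valVar)) []
        mixed-run = subst (λ τs → Run t τs (tabulate (mixed ∘ valVar)) []) (tabulate-≡ mixed-type)
          (Equivalence.to (f-correct mixed) (Equivalence.from (B-computes mixed) accepted))

        mixed-val : ∀ l b → lookup os l ≡ b → lookup (tabulate (mixed ∘ valVar)) l ≡ lookup (vals (if b then i else j)) l
        mixed-val l b e
          rewrite lookup∘tabulate (mixed ∘ valVar) l | lookup∘tabulate (λ l → position l <ᵇ k) l | e with b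
        ... | true  = input-val i l
        ... | false = input-val j l

        -- The mixed input agrees with input `i` before the cut and with input `j` after it; either
        -- side alone determines all values, so the two inputs coincide.
        mixed≡vals : ∀ b → tabulate (mixed ∘ valVar) ≡ vals (if b then i else j)
        mixed≡vals b = proj₁ (run-determined b os true (λ l → mixed-val l b) refl refl (λ _ → refl)
          mixed-run (vals-run (if b then i else j)))

        bits≡ : ∀ {q} → q < t → bits t i q ≡ bits t j q
        bits≡ {q} q<t = fill-injective os true [] balanced (trans (sym (mixed≡vals true)) (mixed≡vals false))
          (subst (q <_) (sym (occ≡t true)) q<t)

-- The separating function and its upper bound.

module HardFunction {n d : ℕ} (t : ℕ) (width≤d : 2 ^ (2 + t) ≤ d) (vars≤n : (t + t) * 2 ≤ n) where
  open StackMachine t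
  open PairedVariables t vars≤n public

  machine : OBDD n d
  machine = obdd (t + t) (just [])
    (≤-trans (m^n>0 2 (2 + t)) width≤d) (≤-trans (≤-reflexive length-states) width≤d) isEmpty

  -- Taking the function that the machine computes makes the upper bound immediate; what remains is
  -- to identify the accepted inputs.
  hard : BoolFun n
  hard = OBDD.eval machine

  hard≡runBlocks : ∀ ν → hard ν ≡ isEmpty (runBlocks (tabulate (ν ∘ typeVar)) (tabulate (ν ∘ valVar)) (just []))
  hard≡runBlocks ν = begin
    hard ν
      ≡⟨ eval≡iter (t + t) (just []) _ _ isEmpty ν ⟩
    isEmpty (iter (t + t) (just []) (ext ν) n)
      ≡⟨ cong isEmpty (iter≡runBlocks (t + t) (just []) (ext ν) n (cap-≤ z≤n) vars≤n) ⟩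
    isEmpty (runBlocks (evens (t + t) (ext ν)) (odds (t + t) (ext ν)) (just []))
      ≡⟨ cong₂ (λ τs vs → isEmpty (runBlocks τs vs (just [])))
           (tabulate-cong (λ i → ext-< ν (typeVar<n i))) (tabulate-cong (λ i → ext-< ν (valVar<n i))) ⟩
    isEmpty (runBlocks (tabulate (ν ∘ typeVar)) (tabulate (ν ∘ valVar)) (just [])) ∎
    where open ≡-Reasoning

  hard-correct : ∀ ν → hard ν ≡ true ⇔ StackAccepted ν
  hard-correct ν = mk⇔
    (λ e → runBlocks-sound _ _ [] (trans (sym (hard≡runBlocks ν)) e))
    (λ r → trans (hard≡runBlocks ν) (cong isEmpty (runBlocks-complete _ _ [] r)))

-- Choice of the parameter `t`.

binary-magnitude : ∀ d → 1 ≤ d → ∃ λ e → 2 ^ e ≤ d × d < 2 ^ suc e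
binary-magnitude (suc zero)      _ = 0 , ≤-refl , ≤-refl
binary-magnitude (suc d@(suc _)) _ with binary-magnitude d (s≤s z≤n)
... | e , lo , hi with suc d <? 2 ^ suc e
...   | yes hi′ = e , m≤n⇒m≤1+n lo , hi′
...   | no  hi′ = suc e , ≮⇒≥ hi′ , <-≤-trans (s≤s hi) (^-monoʳ-< 2 ≤-refl (n<1+n (suc e)))

-- The bound d ≤ 2^(n/4) is stated as a fourth power to stay within the natural numbers.
theorem9 : (n d : ℕ) → 16 ≤ d → d ^ 4 ≤ 2 ^ n →
    (InOBDD n (d / 8 ∸ 1) ⊊ InOBDD n d) × (InNOBDD n (d / 8 ∸ 1) ⊊ InNOBDD n d)
theorem9 n d 16≤d d⁴≤2ⁿ with binary-magnitude d (≤-trans (s≤s z≤n) 16≤d)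
-- The exponent is to be `2 + t`; the values 0 and 1 contradict `16≤d`.
... | zero , _ , d<2 = contradiction (≤-trans (m≤m+n 2 14) 16≤d) (<⇒≱ d<2)
... | suc zero , _ , d<4 = contradiction (≤-trans (m≤m+n 4 12) 16≤d) (<⇒≱ d<4)
... | suc (suc t) , lo , hi =
  -- One function separates both hierarchies: it is easy deterministically and hard even
  -- nondeterministically.
  (OBDD-mono m≤d , hard , in-OBDD , hard∉NOBDD ∘ OBDD⇒NOBDD hard) ,
  (NOBDD-mono m≤d , hard , OBDD⇒NOBDD hard in-OBDD , hard∉NOBDD)
  where
  m≤d : d / 8 ∸ 1 ≤ d
  m≤d = ≤-trans (m∸n≤m (d / 8) 1) (m/n≤m d 8)

  m<2^t : d / 8 ∸ 1 < 2 ^ t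
  -- From d < 2^(t+3) = 2^t * 8 follows ⌊d/8⌋ < 2^t.
  m<2^t = ≤-<-trans (m∸n≤m (d / 8) 1) (m<n*o⇒m/o<n {d} {2 ^ t} {8}
    (subst (d <_) (trans (cong (2 ^_) (+-comm 3 t)) (^-distribˡ-+-* 2 t 3)) hi))

  4[2+t]≤n : (2 + t) * 4 ≤ n
  -- Compare exponents in 2^((2+t)*4) ≤ d^4 ≤ 2^n.
  4[2+t]≤n = ≮⇒≥ λ n< → <⇒≱ (^-monoʳ-< 2 ≤-refl n<)
    (≤-trans (≤-reflexive (sym (^-*-assoc 2 (2 + t) 4))) (≤-trans (^-monoˡ-≤ 4 lo) d⁴≤2ⁿ))

  vars≤n : (t + t) * 2 ≤ n
  vars≤n = ≤-trans (≤-reflexive 2t*2≡t*4) (≤-trans (*-monoˡ-≤ 4 (m≤n+m t 2)) 4[2+t]≤n)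
    where
    2t*2≡t*4 : (t + t) * 2 ≡ t * 4
    2t*2≡t*4 = trans (*-distribʳ-+ 2 t t) (sym (*-distribˡ-+ t 2 2))

  open HardFunction {n} {d} t lo vars≤n

  hard∉NOBDD : ¬ InNOBDD n (d / 8 ∸ 1) hard
  hard∉NOBDD = StackAccepted-hard m<2^t hard-correct

  in-OBDD : InOBDD n d hard
  in-OBDD = machine , λ _ → refl
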